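{- Let $\mathcal{S}$ be a nonempty set with a scene space basis $\mathcal{B}$, let $V$ be a set and $e:\mathcal{S}\to V$ an expression. Then $FV(e)$ is the smallest set of variables with the coincidence effect property for $e$. That is: (1) for all $s,s'\in\mathcal{S}$, if $s\approx s'$ on $\bigcup FV(e)$ then $e(s)=e(s')$; and (2) if $T\subseteq\mathcal{B}$ is such that for all $s,s'\in\mathcal{S}$, $s\approx s'$ on $\bigcup T$ implies $e(s)=e(s')$, then $FV(e)\subseteq T$.
   Context: Scenes. Let $\mathcal{S}$ be a nonempty set (of states). A scene on $\mathcal{S}$ is a function $A:\mathcal{S}\to\mathcal{S}\to\mathcal{S}$ satisfying for all $x,y,z$: $A\,(A\,x\,y)\,z = A\,x\,z$, $A\,x\,(A\,y\,z)=A\,x\,z$, $A\,x\,x=x$. Write $\bot = (\lambda s_1\,s_2.\ s_1)$, $\top=(\lambda s_1\,s_2.\ s_2)$, $A^{\complement}=(\lambda s_1\,s_2.\ A\,s_2\,s_1)$, $A\sqcup B=(\lambda s_1\,s_2.\ B\,(A\,s_1\,s_2)\,s_2)$. Scenes $A,B$ are independent if $B\,(A\,s_1\,s_2)\,s_3=A\,(B\,s_1\,s_3)\,s_2$ for all $s_1,s_2,s_3$. Write "$s_1\approx s_2$ on $A$" for $A\,s_1\,s_2=s_1$. A scene space basis is a finite sequence of scenes $S_1,\dots,S_n$ with $S_i,S_j$ independent for $i\neq j$ and $S_1\sqcup\cdots\sqcup S_n=\top$; $\mathcal{B}=\{S_1,\dots,S_n\}$ (the variables). For a set $X\subseteq\mathcal{B}$,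 $\bigcup X$ denotes the $\sqcup$ of all its elements (in any order, the result being independent of it), with $\bigcup\emptyset=\bot$. Free variables: $FV(e)=\{x\in\mathcal{B} : \exists s,s'.\ s\approx s' \text{ on } x^{\complement} \text{ and } e(s)\ne e(s')\}$. -}

module Defs where

open import Axiom.ExcludedMiddle using (ExcludedMiddle)
open import Data.Fin using (Fin)
open import Data.Fin.Subset using (Subset)
open import Data.Fin.Subset.Properties using (_∈?_)
open import Data.List using (List; foldr; map; filter; allFin)
open import Data.Nat using (ℕ)
open import Data.Product using (_×_; ∃₂)
open import Data.Vec using (tabulate)
open import Level using (Level) renaming (_⊔_ to _⊔ˡ_)
open import Relation.Binary.PropositionalEquality using (_≡_; _≢_)
open import Relation.Nullary using (does)

private
  variable
    a b : Level
    S : Set a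
    V : Set b
    n : ℕ

-- Equality of these functions is always taken pointwise, so function
-- extensionality is never needed.
Override : Set a → Set a
Override S = S → S → S

record IsScene {a : Level} {S : Set a} (A : Override S) : Set a where
  field
    overrideˡ : ∀ x y z → A (A x y) z ≡ A x z
    overrideʳ : ∀ x y z → A x (A y z) ≡ A x z
    idem      : ∀ x → A x x ≡ x

⊥ˢ : Override S
⊥ˢ s₁ s₂ = s₁

⊤ˢ : Override S
⊤ˢ s₁ s₂ = s₂

infix 8 _∁
_∁ : Override S → Override S
(A ∁) s₁ s₂ = A s₂ s₁

infixr 6 _⊔_
_⊔_ : Override S → Override S → Override S
(A ⊔ B) s₁ s₂ = B (A s₁ s₂) s₂

Independent : {S : Set a} → Override S → Override S → Set a
Independent A B = ∀ s₁ s₂ s₃ → B (A s₁ s₂) s₃ ≡ A (B s₁ s₃) s₂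

infix 4 _≈_on_
_≈_on_ : {S : Set a} → S → S → Override S → Set a
s₁ ≈ s₂ on A = A s₁ s₂ ≡ s₁

-- _⊔_ is definitionally associative with unit ⊥ˢ, so the bracketing and the
-- trailing ⊥ˢ do not matter.
⨆ : List (Override S) → Override S
⨆ = foldr _⊔_ ⊥ˢ

-- Variables are referred to by their index. The sequence may repeat a scene,
-- but only ⊥ˢ: if var i and var j agree for i ≢ j, then var i is independent
-- of itself, which forces var i s₁ s₂ ≡ s₁. As ⊥ˢ is never a free variable and
-- contributes nothing to a join, sets of indices and sets of scenes are
-- interchangeable below.
record SceneSpaceBasis {a : Level} (S : Set a) (n : ℕ) : Set a where
  field
    var         : Fin n → Override S
    isScene     : ∀ i → IsScene (var i)
    independent : ∀ i j → i ≢ j → Independent (var i) (var j)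
    covers      : ∀ s₁ s₂ → ⨆ (map var (allFin n)) s₁ s₂ ≡ ⊤ˢ s₁ s₂

open SceneSpaceBasis public

-- Joined in index order; by independence any other order gives the same result.
⋃ : SceneSpaceBasis S n → Subset n → Override S
⋃ B X = ⨆ (map (var B) (filter (_∈? X) (allFin _)))

Free : {S : Set a} {V : Set b} → SceneSpaceBasis S n → (S → V) → Fin n → Set (a ⊔ˡ b)
Free B e i = ∃₂ λ s s′ → (s ≈ s′ on (var B i) ∁) × (e s ≢ e s′)

-- Excluded middle is what allows set comprehension over the variables: being
-- free is not decidable in general, whereas joins need a concrete finite set.
FV : {S : Set a} {V : Set b} → ExcludedMiddle (a ⊔ˡ b) →
     SceneSpaceBasis S n → (S → V) → Subset n
FV em B e = tabulate λ i → does (em {Free B e i})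

CoincidenceEffect : {S : Set a} {V : Set b} →
                    SceneSpaceBasis S n → (S → V) → Subset n → Set (a ⊔ˡ b)
CoincidenceEffect B e X = ∀ s s′ → s ≈ s′ on ⋃ B X → e s ≡ e s′

{-# OPTIONS --safe #-}
-- To pass from s to s′, override by s′ one variable after another; as the
-- variables cover the state, this ends in s′. If s and s′ agree on the free
-- variables, then every step at a free variable is trivial, and a step at any
-- other variable does not change the value of e. Conversely, states that
-- witness i being free agree on every variable other than i, hence on ⋃ T
-- whenever i ∉ T.
module Submission where

open import Defs
open import Axiom.ExcludedMiddle using (ExcludedMiddle)
open import Data.Bool using (true)
open import Data.Empty using (⊥-elim)
open import Data.Fin using (Fin; _≟_)
open import Data.Fin.Subset using (Subset; _⊆_) renaming (_∈_ to _∈ˢ_)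
open import Data.Fin.Subset.Properties using (_∈?_)
open import Data.List using (List; []; _∷_; map; allFin)
open import Data.List.Membership.Propositional using (_∈_)
open import Data.List.Membership.Propositional.Properties using (∈-allFin; ∈-filter⁺; ∈-filter⁻)
open import Data.List.Relation.Unary.Any using (here; there)
open import Data.Nat using (ℕ)
open import Data.Product using (_×_; _,_; proj₂)
open import Data.Vec.Properties using (lookup∘tabulate; lookup⇒[]=; []=⇒lookup)
open import Function using (_∘_)
open import Level using (Level; Lift; lift) renaming (_⊔_ to _⊔ˡ_)
open import Relation.Binary.PropositionalEquality
open import Relation.Nullary using (Dec; does; yes; no)
open import Relation.Nullary.Decidable using (dec-true)

private
  variable
    a b : Level
    S : Set a
    V : Set b
    n : ℕ

does-true⇒ : {P : Set a} (P? : Dec P) → does P? ≡ true → P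
does-true⇒ (yes p) _ = p

∈-FV⁺ : (em : ExcludedMiddle (a ⊔ˡ b)) {S : Set a} {V : Set b}
        (B : SceneSpaceBasis S n) (e : S → V) {i : Fin n} → Free B e i → i ∈ˢ FV em B e
∈-FV⁺ em B e {i} free =
  lookup⇒[]= i _ (trans (lookup∘tabulate _ i) (dec-true em free))

∈-FV⁻ : (em : ExcludedMiddle (a ⊔ˡ b)) {S : Set a} {V : Set b}
        (B : SceneSpaceBasis S n) (e : S → V) {i : Fin n} → i ∈ˢ FV em B e → Free B e i
∈-FV⁻ em B e {i} i∈FV =
  does-true⇒ em (trans (sym (lookup∘tabulate _ i)) ([]=⇒lookup i∈FV))

module _ {S : Set a} (B : SceneSpaceBasis S n) where

  -- Independence speaks only of distinct indices, but with a common source `s` the case `i ≡ j` is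
  -- trivial, so no case split is needed later.
  var-comm : ∀ i j t s → var B j (var B i t s) s ≡ var B i (var B j t s) s
  var-comm i j t s with i ≟ j
  ... | yes refl = refl
  ... | no i≢j   = independent B i j i≢j t s s

  -- The override at `i` moves inside the one at `j`, where it meets `t` and does nothing.
  ≈-on-var-override : ∀ i j {t s} → t ≈ s on var B i → var B j t s ≈ s on var B i
  ≈-on-var-override i j {t} {s} t≈s =
    trans (var-comm j i t s) (cong (λ u → var B j u s) t≈s)

  ≈-on-var-⨆ : ∀ i L {t s} → t ≈ s on var B i → ⨆ (map (var B) L) t s ≈ s on var B i
  ≈-on-var-⨆ i []      t≈s = t≈s
  ≈-on-var-⨆ i (j ∷ L) t≈s = ≈-on-var-⨆ i L (≈-on-var-override i j t≈s)

  -- The step at `i` creates the agreement, by `overrideˡ`, and all later steps keep it.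
  ⨆-≈-on-member : ∀ {i L} → i ∈ L → ∀ t s → ⨆ (map (var B) L) t s ≈ s on var B i
  ⨆-≈-on-member {i} {_ ∷ L} (here refl) t s =
    ≈-on-var-⨆ i L (IsScene.overrideˡ (isScene B i) t s s)
  ⨆-≈-on-member {L = j ∷ _} (there i∈L) t s = ⨆-≈-on-member i∈L (var B j t s) s

  ≈-on-⨆⁺ : ∀ L {t s} → (∀ {i} → i ∈ L → t ≈ s on var B i) → t ≈ s on ⨆ (map (var B) L)
  ≈-on-⨆⁺ []      t≈s = refl
  ≈-on-⨆⁺ (j ∷ L) {t} {s} t≈s =
    trans (cong (λ u → ⨆ (map (var B) L) u s) (t≈s (here refl))) (≈-on-⨆⁺ L (t≈s ∘ there))

  ≈-on-⋃⁻ : ∀ X {t s} → t ≈ s on ⋃ B X → ∀ {i} → i ∈ˢ X → t ≈ s on var B i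
  ≈-on-⋃⁻ X {t} {s} t≈s {i} i∈X =
    -- `t≈s` says that the overridden state is `t` itself.
    subst (_≈ s on var B i) t≈s
      (⨆-≈-on-member (∈-filter⁺ (_∈? X) (∈-allFin i) i∈X) t s)

  ≈-on-⋃⁺ : ∀ X {t s} → (∀ {i} → i ∈ˢ X → t ≈ s on var B i) → t ≈ s on ⋃ B X
  ≈-on-⋃⁺ X t≈s = ≈-on-⨆⁺ _ λ i∈L → t≈s (proj₂ (∈-filter⁻ (_∈? X) {xs = allFin n} i∈L))

  override-≈-on-∁ : ∀ i t s → var B i t s ≈ t on (var B i) ∁
  override-≈-on-∁ i t s = IsScene.overrideʳ (isScene B i) t t s

  -- The hypothesis presents `t` as `s` changed only at `i`. By independence the override at `j`
  -- reaches `s` first, and there it is trivial by `idem`.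
  ≈-on-∁⇒≈-on-other : ∀ {i j t s} → i ≢ j → t ≈ s on (var B i) ∁ → t ≈ s on var B j
  ≈-on-∁⇒≈-on-other {i} {j} {t} {s} i≢j t≈s = begin
    var B j t s                ≡⟨ cong (λ u → var B j u s) t≈s ⟨
    var B j (var B i s t) s    ≡⟨ independent B i j i≢j s t s ⟩
    var B i (var B j s s) t    ≡⟨ cong (λ u → var B i u t) (IsScene.idem (isScene B j) s) ⟩
    var B i s t                ≡⟨ t≈s ⟩
    t                          ∎
    where open ≡-Reasoning

module _ (em : ExcludedMiddle (a ⊔ˡ b)) {S : Set a} {V : Set b}
         (B : SceneSpaceBasis S n) (e : S → V) where

  AgreeOnFV : S → S → Set a
  AgreeOnFV t s = ∀ {i} → i ∈ˢ FV em B e → t ≈ s on var B i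

  override-preserves : ∀ i {t s} → AgreeOnFV t s → e (var B i t s) ≡ e t
  -- `Lift` raises the equation in `V` to the level at which `em` decides.
  override-preserves i {t} {s} t≈s with em {Lift a (e (var B i t s) ≡ e t)}
  ... | yes (lift eq) = eq
  ... | no  neq       = ⊥-elim (neq (lift (cong e (t≈s (∈-FV⁺ em B e i-free)))))
    where
    i-free : Free B e i
    i-free = var B i t s , t , override-≈-on-∁ B i t s , neq ∘ lift

  -- Each override by `s` keeps `AgreeOnFV`, so the induction can continue from the changed state.
  ⨆-preserves : ∀ L {t s} → AgreeOnFV t s → e (⨆ (map (var B) L) t s) ≡ e t
  ⨆-preserves []      t≈s = refl
  ⨆-preserves (j ∷ L) t≈s =
    trans (⨆-preserves L λ {i} i∈FV → ≈-on-var-override B i j (t≈s i∈FV))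
          (override-preserves j t≈s)

  FV-coincidence : CoincidenceEffect B e (FV em B e)
  FV-coincidence s s′ s≈s′ =
    trans (sym (⨆-preserves (allFin n) (≈-on-⋃⁻ B (FV em B e) s≈s′)))
          (cong e (covers B s s′))

free⇒∈-coincidence : {S : Set a} {V : Set b} (B : SceneSpaceBasis S n) (e : S → V) →
                     ∀ T → CoincidenceEffect B e T → ∀ {i} → Free B e i → i ∈ˢ T
free⇒∈-coincidence B e T coincide {i} (s , s′ , s≈s′ , es≢es′) with i ∈? T
... | yes i∈T = i∈T
... | no  i∉T = ⊥-elim (es≢es′ (coincide s s′ (≈-on-⋃⁺ B T λ j∈T →
                  ≈-on-∁⇒≈-on-other B (λ { refl → i∉T j∈T }) s≈s′)))

lemma30 : {a b : Level} (em : ExcludedMiddle (a ⊔ˡ b))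
    {S : Set a} {V : Set b} (s₀ : S) {n : ℕ}
    (B : SceneSpaceBasis S n) (e : S → V) →
    CoincidenceEffect B e (FV em B e) ×
    ((T : Subset n) → CoincidenceEffect B e T → FV em B e ⊆ T)
lemma30 em s₀ B e =
  FV-coincidence em B e ,
  λ T coincide i∈FV → free⇒∈-coincidence B e T coincide (∈-FV⁻ em B e i∈FV)
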